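{- Let $\frac12\le p<1$ and let $X_n$ be the number of correct guesses in the complete-feedback card guessing game after one asymmetric single-shelf shuffle with parameter $p$ of $n$ cards. Then the generating function $S(z,v)=\sum_{n\ge1}\mathbb E(v^{X_n})z^n$ is given by $$S(z,v)=\frac{ -z\bigl(1+(v-1)(p-1)z\bigr)v}{zv-1+pv(v-1)(p-1)z^2},$$ and for all $n\ge3$ $$\mathbb E(X_n)=(1-p+p^2)\,n+3p-1-2p^2,$$ $$\mathbb V(X_n)=(1-p)p(3p^2-3p+1)\,n+p(1-p)(10p-8p^2-3).$$
   Context: Asymmetric single-shelf shuffle with parameter $p\in(0,1)$: an ordered deck of $n$ cards labelled $1,\dots,n$ (card $1$ on top, card $n$ at the bottom) is given. Cards are drawn one by one from the bottom of the deck (so in the order $n,n-1,\dots,1$) and put on an initially empty pile; each drawn card is placed, independently, at the top of the pile with probability $p$ and at the bottom of the pile with probability $1-p$. The final pile is the shuffled deck. Game: cards are drawn one after the other from the top of the shuffled deck. Before each draw the player guesses the label of the card; afterwards the card is shown (complete feedback). For $p\ge\frac12$ the player uses the following optimal strategy: the first guess is card $1$; as long as neither card $n-1$ nor card $n$ has been shown, the next guess is the label immediately following that of the most recently shown card; once one of the cards $n-1$ or $n$ has been shown, the player guesses the remaining (not yet shown) cards in descending order. $X_n$ denotes the total number of correct guesses; $\mathbb V$ denotes variance. The generating function identity is understood as an identity of formal power series in $z$. -}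

module Defs where

open import Level using (Level; _⊔_) renaming (suc to lsuc)
open import Algebra.Apartness.Bundles using (HeytingField; HeytingCommutativeRing)
open import Algebra.Bundles using (CommutativeRing; Semiring)
import Algebra.Definitions.RawSemiring as RawSemiringDefs
open import Data.Bool.Base using (if_then_else_; _∨_)
open import Data.Fin.Base using (toℕ)
open import Data.List.Base using (List; []; _∷_; _++_; [_]; map; foldr)
open import Data.Nat.Base using (ℕ; zero; suc; _∸_) renaming (_+_ to _+ℕ_)
open import Data.Nat.Properties using (_≟_)
open import Data.List.Membership.DecPropositional _≟_ using (_∈?_)
open import Data.Product.Base using (_×_; _,_; proj₁; ∃-syntax)
open import Data.Sum.Base using (_⊎_; inj₁)
open import Data.Vec.Base as Vec using (Vec; []; _∷_)
open import Relation.Binary.Core using (Rel)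
open import Relation.Binary.Structures using (IsStrictPartialOrder)
open import Relation.Nullary using (¬_; does)

data Side : Set where
  top bottom : Side

place : Side → ℕ → List ℕ → List ℕ
place top    c pile = c ∷ pile
place bottom c pile = pile ++ [ c ]

-- With m+1 cards 1,…,m+1 left in the ordered deck, the next card drawn from
-- its bottom is m+1; the first entry of the vector tells where it goes.
drawAll : ∀ {m} → Vec Side m → List ℕ → List ℕ
drawAll         []       pile = pile
drawAll {suc m} (s ∷ ss) pile = drawAll ss (place s (suc m) pile)

-- Topmost card first.
shuffle : ∀ {n} → Vec Side n → List ℕ
shuffle sides = drawAll sides []

-- The largest label in {1,…,n} not in the list (0 if there is none, which
-- does not happen while cards remain to be drawn).
largestUnseen : ℕ → List ℕ → ℕ
largestUnseen zero    shown = zero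
largestUnseen (suc m) shown =
  if does (suc m ∈? shown) then largestUnseen m shown else suc m

-- The guess of the player, given the cards shown so far (latest first).
-- For n = 1, n ∸ 1 = 0 is not the label of a card, so it is never shown.
guess : ℕ → List ℕ → ℕ
guess n []              = 1
guess n shown@(c ∷ _) =
  if does (n ∸ 1 ∈? shown) ∨ does (n ∈? shown)
  then largestUnseen n shown
  else suc c

play : ℕ → List ℕ → List ℕ → ℕ
play n shown []       = 0
play n shown (c ∷ cs) =
  (if does (guess n shown ≟ c) then 1 else 0) +ℕ play n (c ∷ shown) cs

X : ∀ {n} → Vec Side n → ℕ
X {n} sides = play n [] (shuffle sides)

outcomes : ∀ n → List (Vec Side n)
outcomes zero    = [ [] ]
outcomes (suc n) = map (top ∷_) (outcomes n) ++ map (bottom ∷_) (outcomes n)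

-- The axioms are constructive ones, so that the real numbers are a model:
-- the order is not assumed decidable, and x ≤ y means ¬ (y < x).
record OrderedField c ℓ₁ ℓ₂ ℓ₃ : Set (lsuc (c ⊔ ℓ₁ ⊔ ℓ₂ ⊔ ℓ₃)) where
  field
    heytingField : HeytingField c ℓ₁ ℓ₂

  open HeytingField heytingField public

  infix 4 _<_ _≤_
  field
    _<_                  : Rel Carrier ℓ₃
    isStrictPartialOrder : IsStrictPartialOrder _≈_ _<_
    #⇒<⊎>                : ∀ {x y} → x # y → x < y ⊎ y < x
    <⊎>⇒#                : ∀ {x y} → x < y ⊎ y < x → x # y
    +-monoˡ-<            : ∀ z {x y} → x < y → x + z < y + z
    *-pos                : ∀ {x y} → 0# < x → 0# < y → 0# < x * y
    0<1                  : 0# < 1#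

  _≤_ : Rel Carrier ℓ₃
  x ≤ y = ¬ (y < x)

  commutativeRing : CommutativeRing c ℓ₁
  commutativeRing = HeytingCommutativeRing.commutativeRing
    (HeytingField.heytingCommutativeRing heytingField)

  open IsStrictPartialOrder isStrictPartialOrder public
    using (<-resp-≈; <-respˡ-≈; <-respʳ-≈)
    renaming (trans to <-trans; irrefl to <-irrefl)

  0<2 : 0# < 1# + 1#
  0<2 = <-trans 0<1 (<-respˡ-≈ (+-identityˡ 1#) (+-monoˡ-< 1# 0<1))

  -- The inverse of (1# + 1#) - 0#.
  ½ : Carrier
  ½ = proj₁ (#⇒invertible (#-sym (<⊎>⇒# (inj₁ 0<2))))

-- Formal power series in z, given by their coefficients.
module PowerSeries {c ℓ} (R : CommutativeRing c ℓ) where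
  open CommutativeRing R
  open RawSemiringDefs (Semiring.rawSemiring semiring) using (sum)

  Series : Set c
  Series = ℕ → Carrier

  infix  4 _≋_
  infix  8 ⊖_
  infixl 7 _⊛_
  infixl 6 _⊕_ _⊖_

  _≋_ : Rel Series ℓ
  f ≋ g = ∀ n → f n ≈ g n

  const : Carrier → Series
  const a zero    = a
  const a (suc _) = 0#

  z : Series
  z 1 = 1#
  z _ = 0#

  _⊕_ _⊖_ _⊛_ : Series → Series → Series
  (f ⊕ g) n = f n + g n
  (f ⊖ g) n = f n - g n
  (f ⊛ g) n = sum {suc n} (λ i → f (toℕ i) * g (n ∸ toℕ i))

  ⊖_ : Series → Series
  (⊖ f) n = - f n

  -- h is the quotient f / g: g is a unit of the ring of series, and h is f
  -- times its (unique) inverse.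
  _≋_⊘_ : Series → Series → Series → Set (c ⊔ ℓ)
  h ≋ f ⊘ g = ∃[ g⁻¹ ] (g ⊛ g⁻¹ ≋ const 1# × h ≋ f ⊛ g⁻¹)

  infix 4 _≋_⊘_

module Shelf {c ℓ₁ ℓ₂ ℓ₃} (K : OrderedField c ℓ₁ ℓ₂ ℓ₃)
             (p : OrderedField.Carrier K) where
  open OrderedField K
  open RawSemiringDefs
    (Semiring.rawSemiring (CommutativeRing.semiring commutativeRing)) public
    using (_^_) renaming (_×_ to _·_)
  open PowerSeries commutativeRing public

  ι : ℕ → Carrier
  ι n = n · 1#

  weight : Side → Carrier
  weight top    = p
  weight bottom = 1# - p

  prob : ∀ {n} → Vec Side n → Carrier
  prob sides = Vec.foldr′ _*_ 1# (Vec.map weight sides)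

  𝔼 : ∀ {n} → (Vec Side n → Carrier) → Carrier
  𝔼 {n} Y = foldr _+_ 0# (map (λ ω → prob ω * Y ω) (outcomes n))

  𝕍 : ∀ {n} → (Vec Side n → Carrier) → Carrier
  𝕍 Y = 𝔼 (λ ω → (Y ω - 𝔼 Y) ^ 2)

  S : Carrier → Series
  S v zero      = 0#
  S v n@(suc _) = 𝔼 {n} (λ ω → v ^ X ω)

-- Whichever way card n is put, the pile consists of the cards placed at the top
-- in ascending order, card n, and the cards placed at the bottom in descending
-- order. Every card of the descending part is guessed correctly, and a card k of
-- the ascending part, n included, is guessed correctly unless k - 1 is in the
-- descending part. Hence X is n minus the number of top placements (that of n
-- counting as one) immediately followed by a bottom placement. Conditioning on
-- the first placements gives, for every f,
--   E f(Xₙ) = E f(Xₙ₋₁ + 1) + p (1 - p) (E f(Xₙ₋₂ + 1) - E f(Xₙ₋₂ + 2)),   n ≥ 3.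
-- For f k = vᵏ this is the linear recurrence encoded by the denominator of S;
-- for f k = k and f k = k² it determines the first two moments.

module Submission where

open import Defs
open import Algebra.Bundles using (CommutativeRing)
import Algebra.Properties.Ring as RingProperties
import Algebra.Properties.Semiring.Mult.TCOptimised as SemiringMult
import Algebra.Solver.Ring as RingSolver
open import Algebra.Solver.Ring.AlmostCommutativeRing
  using (fromCommutativeRing; _-Raw-AlmostCommutative⟶_)
open import Data.Bool.Base using (if_then_else_)
open import Data.Bool.Properties using (∨-zeroʳ)
open import Data.Empty using (⊥-elim)
open import Data.Integer.Base as ℤ using (ℤ)
import Data.Integer.Properties as ℤ
open import Data.List.Base using (List; []; _∷_; [_]; _++_; _ʳ++_; foldr; map)
open import Data.List.Membership.Propositional using (_∈_; _∉_)
open import Data.List.Properties using (++-identityʳ; ++-assoc)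
open import Data.List.Relation.Unary.All as All using (All; []; _∷_)
open import Data.List.Relation.Unary.Any using (here; there)
open import Data.Maybe.Base using (Maybe; just; nothing)
open import Data.Nat.Base using (ℕ; zero; suc; _∸_; s≤s)
  renaming (_+_ to _+ℕ_; _≤_ to _≤ℕ_; _<_ to _<ℕ_)
import Data.Nat.Properties as ℕ
open import Data.List.Membership.DecPropositional ℕ._≟_ using (_∈?_)
open import Data.Product.Base using (_×_; _,_)
open import Data.Sum.Base using (inj₁; inj₂)
open import Data.Vec.Base using (Vec; []; _∷_)
open import Function.Base using (_∘_)
import Relation.Binary.Reasoning.Setoid as ≈-Reasoning
open import Relation.Binary.PropositionalEquality as ≡ using (_≡_; _≢_)
open import Relation.Nullary using (does; yes; no)
open import Relation.Nullary.Decidable using (dec-true; dec-false)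

private variable
  m n : ℕ

-- The number of correct guesses

module Score where
  open import Data.Nat.Base using (_+_)
  open ≡ using (refl; sym; trans; cong; cong₂)

  -- Both lists are in the order of drawing from the ordered deck, hence descending. For `tops` this
  -- is also the order, latest first, in which `shown` records these cards during the game.
  tops bottoms : Vec Side m → List ℕ
  tops    []                    = []
  tops    {suc m} (top    ∷ ss) = suc m ∷ tops ss
  tops            (bottom ∷ ss) = tops ss
  bottoms []                    = []
  bottoms         (top    ∷ ss) = bottoms ss
  bottoms {suc m} (bottom ∷ ss) = suc m ∷ bottoms ss

  -- A card placed at the top covers all those placed there before, so `tops ss` appears reversed
  -- above the pile, while a card placed at the bottom goes below its predecessors and keeps the
  -- order of drawing.
  drawAll-shape : (ss : Vec Side m) (pile : List ℕ) →
                  drawAll ss pile ≡ tops ss ʳ++ (pile ++ bottoms ss)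
  drawAll-shape []                    pile = sym (++-identityʳ pile)
  drawAll-shape         (top    ∷ ss) pile = drawAll-shape ss _
  drawAll-shape {suc m} (bottom ∷ ss) pile = trans
    (drawAll-shape ss (pile ++ [ suc m ]))
    (cong (tops ss ʳ++_) (++-assoc pile [ suc m ] (bottoms ss)))

  shuffle-shape : (s : Side) (ss : Vec Side m) →
                  shuffle (s ∷ ss) ≡ tops ss ʳ++ (suc m ∷ bottoms ss)
  shuffle-shape top    ss = drawAll-shape ss _
  shuffle-shape bottom ss = drawAll-shape ss _

  tops-≤ : (ss : Vec Side m) → All (_≤ℕ m) (tops ss)
  tops-≤ []            = []
  tops-≤ (top    ∷ ss) = ℕ.≤-refl ∷ All.map ℕ.m≤n⇒m≤1+n (tops-≤ ss)
  tops-≤ (bottom ∷ ss) = All.map ℕ.m≤n⇒m≤1+n (tops-≤ ss)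

  ∉-tops : (ss : Vec Side m) → m <ℕ n → n ∉ tops ss
  ∉-tops ss m<n n∈ = ℕ.<⇒≱ m<n (All.lookup (tops-≤ ss) n∈)

  -- The guesses of the player

  largestUnseen-≡ : ∀ {shown} → m <ℕ n → suc m ∉ shown →
    (∀ {j} → suc m <ℕ j → j ≤ℕ n → j ∈ shown) → largestUnseen n shown ≡ suc m
  largestUnseen-≡ {m} {suc n} {shown} (s≤s m≤n) m∉ above with ℕ.m≤n⇒m<n∨m≡n m≤n
  ... | inj₂ refl
    rewrite dec-false (suc m ∈? shown) m∉ = refl
  ... | inj₁ m<n
    rewrite dec-true (suc n ∈? shown) (above (s≤s m<n) ℕ.≤-refl)
    = largestUnseen-≡ m<n m∉ λ m<j j≤n → above m<j (ℕ.m≤n⇒m≤1+n j≤n)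

  -- The value 1 at the empty list makes the first guess an instance of the ascending rule.
  successor : List ℕ → ℕ
  successor []      = 1
  successor (c ∷ _) = suc c

  guess-ascending : ∀ {shown} → n ∸ 1 ∉ shown → n ∉ shown →
                    guess n shown ≡ successor shown
  guess-ascending {n} {[]}            _    _  = refl
  guess-ascending {n} {shown@(_ ∷ _)} n-1∉ n∉
    rewrite dec-false (n ∸ 1 ∈? shown) n-1∉ | dec-false (n ∈? shown) n∉ = refl

  guess-descending₁ : ∀ {shown} → n ∸ 1 ∈ shown → guess n shown ≡ largestUnseen n shown
  guess-descending₁ {n} {shown@(_ ∷ _)} n-1∈
    rewrite dec-true (n ∸ 1 ∈? shown) n-1∈ = refl

  guess-descending₂ : ∀ {shown} → n ∈ shown → guess n shown ≡ largestUnseen n shown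
  guess-descending₂ {n} {shown@(_ ∷ _)} n∈
    rewrite dec-true (n ∈? shown) n∈ | ∨-zeroʳ (does (n ∸ 1 ∈? shown)) = refl

  point : ℕ → ℕ → ℕ
  point g c = if does (g ℕ.≟ c) then 1 else 0

  point-≡ : ∀ {g c} → g ≡ c → point g c ≡ 1
  point-≡ {g} {c} g≡c rewrite dec-true (g ℕ.≟ c) g≡c = refl

  point-≢ : ∀ {g c} → g ≢ c → point g c ≡ 0
  point-≢ {g} {c} g≢c rewrite dec-false (g ℕ.≟ c) g≢c = refl

  -- The points scored by card m+1 when it is shown right after the cards on top
  -- of it, which are those of 1,…,m that were placed at the top.
  hit : Vec Side m → ℕ
  hit []           = 1
  hit (top    ∷ _) = 1
  hit (bottom ∷ _) = 0

  -- If card `m` was placed at the top, it is the card shown last and its successor is guessed. If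
  -- it was placed at the bottom, the card shown last is smaller, or there is none, and the guess is
  -- too small.
  point-next : (ss : Vec Side m) → m <ℕ n → point (guess n (tops ss)) (suc m) ≡ hit ss
  point-next [] _ = refl
  point-next {m} {suc n} (top ∷ ss) (s≤s m≤n) with ℕ.m≤n⇒m<n∨m≡n m≤n
  -- The card shown last is the last but one of the deck, so the player already guesses in
  -- descending order. The largest unseen card is the last one of the deck, and this is still the
  -- successor.
  ... | inj₂ refl = point-≡ (trans
    (guess-descending₁ {suc n} {tops (top ∷ ss)} (here refl))
    (largestUnseen-≡ ℕ.≤-refl (∉-tops (top ∷ ss) ℕ.≤-refl)
      λ m<j j≤m → ⊥-elim (ℕ.<⇒≱ m<j j≤m)))
  ... | inj₁ m<n = point-≡ (guess-ascending {suc n} {tops (top ∷ ss)}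
    (∉-tops (top ∷ ss) m<n) (∉-tops (top ∷ ss) (s≤s m≤n)))
  -- All cards shown are at most `m`, so the guess is at most `suc m`, whereas `suc (suc m)` is
  -- drawn.
  point-next {suc m} {suc n} (bottom ∷ ss) (s≤s m<n) = point-≢ λ eq →
    successor≢ (tops-≤ ss) (trans (sym (guess-ascending {suc n} {tops ss}
      (∉-tops ss m<n) (∉-tops ss (ℕ.m≤n⇒m≤1+n m<n)))) eq)
    where
    successor≢ : ∀ {shown} → All (_≤ℕ m) shown → successor shown ≢ suc (suc m)
    successor≢ []         ()
    successor≢ (c≤m ∷ _) refl = ℕ.1+n≰n c≤m

  -- Points in the ascending and in the descending part of the pile

  hits : Vec Side m → ℕ
  hits []            = 0
  hits (top    ∷ ss) = hits ss + hit ss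
  hits (bottom ∷ ss) = hits ss

  -- The induction splits off the largest card of the ascending part, which is shown last. It
  -- therefore moves to the front of `rest`, which has to be arbitrary, and `n` stays fixed while
  -- `m` decreases.
  play-ascending : (ss : Vec Side m) → m ≤ℕ n → ∀ rest →
    play n [] (tops ss ʳ++ rest) ≡ hits ss + play n (tops ss) rest
  play-ascending []                        _   rest = refl
  play-ascending {suc m} {n} (top    ∷ ss) m<n rest = begin
    play n [] (tops ss ʳ++ (suc m ∷ rest))
      ≡⟨ play-ascending ss (ℕ.<⇒≤ m<n) (suc m ∷ rest) ⟩
    hits ss + (point (guess n (tops ss)) (suc m) + play n (suc m ∷ tops ss) rest)
      ≡⟨ cong (λ k → hits ss + (k + play n (suc m ∷ tops ss) rest)) (point-next ss m<n) ⟩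
    hits ss + (hit ss + play n (suc m ∷ tops ss) rest)
      ≡⟨ ℕ.+-assoc (hits ss) (hit ss) _ ⟨
    hits ss + hit ss + play n (suc m ∷ tops ss) rest ∎
    where open ≡.≡-Reasoning
  play-ascending (bottom ∷ ss) m<n rest = play-ascending ss (ℕ.<⇒≤ m<n) rest

  #bottoms : Vec Side m → ℕ
  #bottoms []            = 0
  #bottoms (top    ∷ ss) = #bottoms ss
  #bottoms (bottom ∷ ss) = suc (#bottoms ss)

  -- The last three hypotheses are an invariant: every card above `m` has been shown, and of the
  -- cards up to `m` exactly those in `tops ss`. So the largest unseen card is always the next one
  -- of `bottoms ss`.
  play-descending : ∀ {shown} (ss : Vec Side m) → n ∈ shown → m ≤ℕ n →
    (∀ {j} → m <ℕ j → j ≤ℕ n → j ∈ shown) →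
    (∀ {j} → j ∈ tops ss → j ∈ shown) →
    (∀ {j} → j ≤ℕ m → j ∈ shown → j ∈ tops ss) →
    play n shown (bottoms ss) ≡ #bottoms ss
  play-descending [] _ _ _ _ _ = refl
  play-descending {suc m} {n} {shown} (top ∷ ss) n∈ m<n above seen unseen =
    play-descending ss n∈ (ℕ.<⇒≤ m<n) above′ (seen ∘ there) unseen′
    where
    above′ : ∀ {j} → m <ℕ j → j ≤ℕ n → j ∈ shown
    above′ m<j j≤n with ℕ.m≤n⇒m<n∨m≡n m<j
    ... | inj₁ 1+m<j = above 1+m<j j≤n
    ... | inj₂ refl  = seen (here refl)
    unseen′ : ∀ {j} → j ≤ℕ m → j ∈ shown → j ∈ tops ss
    unseen′ j≤m j∈ with unseen (ℕ.m≤n⇒m≤1+n j≤m) j∈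
    ... | here refl = ⊥-elim (ℕ.1+n≰n j≤m)
    ... | there j∈′ = j∈′
  play-descending {suc m} {n} {shown} (bottom ∷ ss) n∈ m<n above seen unseen =
    cong₂ _+_
      (point-≡ (trans (guess-descending₂ n∈) (largestUnseen-≡ m<n m∉ above)))
      (play-descending ss (there n∈) (ℕ.<⇒≤ m<n) above′ (there ∘ seen) unseen′)
    where
    m∉ : suc m ∉ shown
    m∉ = ∉-tops ss ℕ.≤-refl ∘ unseen ℕ.≤-refl
    above′ : ∀ {j} → m <ℕ j → j ≤ℕ n → j ∈ suc m ∷ shown
    above′ m<j j≤n with ℕ.m≤n⇒m<n∨m≡n m<j
    ... | inj₁ 1+m<j = there (above 1+m<j j≤n)
    ... | inj₂ refl  = here refl
    unseen′ : ∀ {j} → j ≤ℕ m → j ∈ suc m ∷ shown → j ∈ tops ss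
    unseen′ j≤m (here refl) = ⊥-elim (ℕ.1+n≰n j≤m)
    unseen′ j≤m (there j∈)  = unseen (ℕ.m≤n⇒m≤1+n j≤m) j∈

  -- A point is lost exactly when a top placement is followed by a bottom one; s
  -- is the placement preceding the given ones.
  score : Side → Vec Side m → ℕ
  score s      []            = 1
  score top    (bottom ∷ ss) = score bottom ss
  score bottom (bottom ∷ ss) = suc (score bottom ss)
  score s      (top    ∷ ss) = suc (score top ss)

  [a+b]+1+c : ∀ a b c → a + b + suc c ≡ suc (a + (b + c))
  [a+b]+1+c a b c = trans (ℕ.+-suc (a + b) c) (cong suc (ℕ.+-assoc a b c))

  -- The middle summand is the point of the preceding card: `hit ss` if it was placed at the top,
  -- always 1 if it was placed at the bottom. As `score` passes between these two states, both
  -- identities are proved together.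
  hits+hit+#bottoms : (ss : Vec Side m) → hits ss + (hit ss + #bottoms ss) ≡ score top ss
  hits+1+#bottoms   : (ss : Vec Side m) → hits ss + (1 + #bottoms ss) ≡ score bottom ss

  hits+hit+#bottoms []            = refl
  hits+hit+#bottoms (top    ∷ ss) = trans
    ([a+b]+1+c (hits ss) (hit ss) (#bottoms ss)) (cong suc (hits+hit+#bottoms ss))
  hits+hit+#bottoms (bottom ∷ ss) = hits+1+#bottoms ss

  hits+1+#bottoms []            = refl
  hits+1+#bottoms (top    ∷ ss) = trans
    ([a+b]+1+c (hits ss) (hit ss) (#bottoms ss)) (cong suc (hits+hit+#bottoms ss))
  hits+1+#bottoms (bottom ∷ ss) = trans
    (ℕ.+-suc (hits ss) _) (cong suc (hits+1+#bottoms ss))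

  -- The side s is immaterial: card n is put on an empty pile.
  X≡score : (s : Side) (ss : Vec Side m) → X (s ∷ ss) ≡ score top ss
  X≡score {m} s ss = begin
    play (suc m) [] (shuffle (s ∷ ss))
      ≡⟨ cong (play (suc m) []) (shuffle-shape s ss) ⟩
    play (suc m) [] (tops ss ʳ++ (suc m ∷ bottoms ss))
      ≡⟨ play-ascending ss (ℕ.n≤1+n m) _ ⟩
    hits ss + (point (guess (suc m) (tops ss)) (suc m) +
               play (suc m) (suc m ∷ tops ss) (bottoms ss))
      ≡⟨ cong (λ k → hits ss + k) (cong₂ _+_ (point-next ss ℕ.≤-refl)
           (play-descending ss (here refl) (ℕ.n≤1+n m) above there unseen)) ⟩
    hits ss + (hit ss + #bottoms ss)
      ≡⟨ hits+hit+#bottoms ss ⟩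
    score top ss ∎
    where
    open ≡.≡-Reasoning
    above : ∀ {j} → m <ℕ j → j ≤ℕ suc m → j ∈ suc m ∷ tops ss
    above m<j j≤1+m = here (ℕ.≤-antisym j≤1+m m<j)
    unseen : ∀ {j} → j ≤ℕ m → j ∈ suc m ∷ tops ss → j ∈ tops ss
    unseen j≤m (here refl) = ⊥-elim (ℕ.1+n≰n j≤m)
    unseen j≤m (there j∈)  = j∈

open Score using (score; X≡score)

-- Solving equations in a commutative ring

module IntegerCoefficients {c ℓ} (R : CommutativeRing c ℓ) where
  open import Data.Integer.Base using (+_; -[1+_])
  open CommutativeRing R
  open RingProperties ring
    using (-0#≈0#; -‿involutive; -‿distribˡ-*; -‿distribʳ-*; -‿+-comm)
  open SemiringMult semiring using (1+×; ×-homo-+; ×1-homo-*) renaming (_×_ to _·_)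
  open ≈-Reasoning setoid

  -- Equality of integers is decidable, which that of the ring need not be; with integer
  -- coefficients the solver can cancel terms. The multiple used here makes `1 · 1#` compute to
  -- `1#`.
  ⟦_⟧ℤ : ℤ → Carrier
  ⟦ + n      ⟧ℤ = n · 1#
  ⟦ -[1+ n ] ⟧ℤ = - (suc n · 1#)

  private
    reflexive-ℤ : ∀ {i j} → i ≡ j → ⟦ i ⟧ℤ ≈ ⟦ j ⟧ℤ
    reflexive-ℤ eq = reflexive (≡.cong ⟦_⟧ℤ eq)

    neg-homo : ∀ i → ⟦ ℤ.- i ⟧ℤ ≈ - ⟦ i ⟧ℤ
    neg-homo (+ zero)   = sym -0#≈0#
    neg-homo (+ suc n)  = refl
    neg-homo (-[1+ n ]) = sym (-‿involutive _)

    ⊖-homo : ∀ m n → ⟦ m ℤ.⊖ n ⟧ℤ ≈ m · 1# - n · 1#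
    ⊖-homo m zero = begin
      m · 1#        ≈⟨ +-identityʳ _ ⟨
      m · 1# + 0#   ≈⟨ +-congˡ -0#≈0# ⟨
      m · 1# - 0#   ∎
    ⊖-homo zero    (suc n) = sym (+-identityˡ _)
    ⊖-homo (suc m) (suc n) = begin
      ⟦ suc m ℤ.⊖ suc n ⟧ℤ                ≈⟨ reflexive-ℤ (ℤ.[1+m]⊖[1+n]≡m⊖n m n) ⟩
      ⟦ m ℤ.⊖ n ⟧ℤ                        ≈⟨ ⊖-homo m n ⟩
      -- A zero is inserted as `1# - 1#`, and its two halves raise both multiples by one.
      m · 1# - n · 1#                     ≈⟨ +-congʳ (+-identityʳ _) ⟨
      m · 1# + 0# - n · 1#                ≈⟨ +-congʳ (+-congˡ (-‿inverseʳ 1#)) ⟨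
      m · 1# + (1# - 1#) - n · 1#         ≈⟨ +-congʳ (+-assoc _ _ _) ⟨
      m · 1# + 1# - 1# - n · 1#           ≈⟨ +-assoc _ _ _ ⟩
      m · 1# + 1# + (- 1# - n · 1#)       ≈⟨ +-cong (+-comm _ _) (-‿+-comm _ _) ⟩
      1# + m · 1# - (1# + n · 1#)         ≈⟨ +-cong (1+× m 1#) (-‿cong (1+× n 1#)) ⟨
      suc m · 1# - suc n · 1#             ∎

    +-homo : ∀ i j → ⟦ i ℤ.+ j ⟧ℤ ≈ ⟦ i ⟧ℤ + ⟦ j ⟧ℤ
    +-homo (+ m)    (+ n)    = ×-homo-+ 1# m n
    +-homo (+ m)    -[1+ n ] = ⊖-homo m (suc n)
    +-homo -[1+ m ] (+ n)    = trans (⊖-homo n (suc m)) (+-comm _ _)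
    +-homo -[1+ m ] -[1+ n ] = begin
      ⟦ -[1+ m ] ℤ.+ -[1+ n ] ⟧ℤ
        ≈⟨ reflexive-ℤ (ℤ.neg-distrib-+ (+ suc m) (+ suc n)) ⟨
      - ((suc m +ℕ suc n) · 1#)      ≈⟨ -‿cong (×-homo-+ 1# (suc m) (suc n)) ⟩
      - (suc m · 1# + suc n · 1#)    ≈⟨ -‿+-comm _ _ ⟨
      - (suc m · 1#) - suc n · 1#    ∎

    +*+-homo : ∀ m n → ⟦ + m ℤ.* + n ⟧ℤ ≈ m · 1# * n · 1#
    +*+-homo m n = trans (reflexive-ℤ (≡.sym (ℤ.pos-* m n))) (×1-homo-* m n)

    *-homo : ∀ i j → ⟦ i ℤ.* j ⟧ℤ ≈ ⟦ i ⟧ℤ * ⟦ j ⟧ℤ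
    *-homo (+ m)    (+ n)    = +*+-homo m n
    *-homo (+ m)    -[1+ n ] = begin
      ⟦ + m ℤ.* -[1+ n ] ⟧ℤ
        ≈⟨ reflexive-ℤ (ℤ.neg-distribʳ-* (+ m) (+ suc n)) ⟨
      ⟦ ℤ.- (+ m ℤ.* + suc n) ⟧ℤ     ≈⟨ neg-homo (+ m ℤ.* + suc n) ⟩
      - ⟦ + m ℤ.* + suc n ⟧ℤ         ≈⟨ -‿cong (+*+-homo m (suc n)) ⟩
      - (m · 1# * suc n · 1#)        ≈⟨ -‿distribʳ-* _ _ ⟩
      m · 1# * - (suc n · 1#)        ∎
    *-homo -[1+ m ] (+ n)    = begin
      ⟦ -[1+ m ] ℤ.* + n ⟧ℤ
        ≈⟨ reflexive-ℤ (ℤ.neg-distribˡ-* (+ suc m) (+ n)) ⟨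
      ⟦ ℤ.- (+ suc m ℤ.* + n) ⟧ℤ     ≈⟨ neg-homo (+ suc m ℤ.* + n) ⟩
      - ⟦ + suc m ℤ.* + n ⟧ℤ         ≈⟨ -‿cong (+*+-homo (suc m) n) ⟩
      - (suc m · 1# * n · 1#)        ≈⟨ -‿distribˡ-* _ _ ⟩
      - (suc m · 1#) * n · 1#        ∎
    *-homo -[1+ m ] -[1+ n ] = begin
      ⟦ + suc m ℤ.* + suc n ⟧ℤ       ≈⟨ +*+-homo (suc m) (suc n) ⟩
      suc m · 1# * suc n · 1#        ≈⟨ -‿involutive _ ⟨
      - - (suc m · 1# * suc n · 1#)  ≈⟨ -‿cong (-‿distribʳ-* _ _) ⟩
      - (suc m · 1# * - (suc n · 1#)) ≈⟨ -‿distribˡ-* _ _ ⟩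
      - (suc m · 1#) * - (suc n · 1#) ∎

    morphism : ℤ.+-*-rawRing -Raw-AlmostCommutative⟶ fromCommutativeRing R
    morphism = record
      { ⟦_⟧    = ⟦_⟧ℤ
      ; +-homo = +-homo
      ; *-homo = *-homo
      ; -‿homo = neg-homo
      ; 0-homo = refl
      ; 1-homo = refl
      }

    _coeff≟_ : ∀ i j → Maybe (⟦ i ⟧ℤ ≈ ⟦ j ⟧ℤ)
    i coeff≟ j with i ℤ.≟ j
    ... | yes i≡j = just (reflexive-ℤ i≡j)
    ... | no  _   = nothing

  open RingSolver ℤ.+-*-rawRing (fromCommutativeRing R) morphism _coeff≟_ public
    using (Polynomial; solve; con; _:+_; _:*_; _:-_; :-_; _:^_; _:=_; _:×_)

  :0 :1 : Polynomial n
  :0 = con (+ 0)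
  :1 = con (+ 1)

-- Power series that are quotients of quadratic polynomials

module SeriesProperties {c ℓ} (R : CommutativeRing c ℓ) where
  open CommutativeRing R
  open PowerSeries R
  open IntegerCoefficients R
  open ≈-Reasoning setoid

  -- By computation `(f ⊛ g) (suc n)` is `f 0 * g (suc n) + ((f ∘ suc) ⊛ g) n`. This shift of the
  -- left factor drives all inductions on products.
  ⊛-zeroˡ : ∀ f g → (∀ k → f k ≈ 0#) → ∀ n → (f ⊛ g) n ≈ 0#
  ⊛-zeroˡ f g f≈0 zero = begin
    f 0 * g 0 + 0#   ≈⟨ +-identityʳ _ ⟩
    f 0 * g 0        ≈⟨ *-congʳ (f≈0 0) ⟩
    0# * g 0         ≈⟨ zeroˡ _ ⟩
    0#               ∎
  ⊛-zeroˡ f g f≈0 (suc n) = begin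
    f 0 * g (suc n) + ((f ∘ suc) ⊛ g) n
      ≈⟨ +-cong (*-congʳ (f≈0 0)) (⊛-zeroˡ (f ∘ suc) g (f≈0 ∘ suc) n) ⟩
    0# * g (suc n) + 0#   ≈⟨ +-identityʳ _ ⟩
    0# * g (suc n)        ≈⟨ zeroˡ _ ⟩
    0#                    ∎

  ⊛-constantˡ : ∀ f g → (∀ k → f (suc k) ≈ 0#) → ∀ n → (f ⊛ g) n ≈ f 0 * g n
  ⊛-constantˡ f g f≈0 zero    = +-identityʳ _
  ⊛-constantˡ f g f≈0 (suc n) =
    trans (+-congˡ (⊛-zeroˡ (f ∘ suc) g f≈0 n)) (+-identityʳ _)

  const-⊛ : ∀ a g n → (const a ⊛ g) n ≈ a * g n
  const-⊛ a g = ⊛-constantˡ (const a) g (λ _ → refl)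

  ⊛-const : ∀ g a n → (g ⊛ const a) n ≈ g n * a
  ⊛-const g a zero    = +-identityʳ _
  ⊛-const g a (suc n) =
    trans (+-cong (zeroʳ _) (⊛-const (g ∘ suc) a n)) (+-identityˡ _)

  ⊛-linearˡ : ∀ f g → f 0 ≈ 0# → (∀ k → f (suc (suc k)) ≈ 0#) →
              ∀ n → (f ⊛ g) (suc n) ≈ f 1 * g n
  ⊛-linearˡ f g f₀≈0 f≈0 n = begin
    f 0 * g (suc n) + ((f ∘ suc) ⊛ g) n
      ≈⟨ +-cong (*-congʳ f₀≈0) (⊛-constantˡ (f ∘ suc) g f≈0 n) ⟩
    0# * g (suc n) + f 1 * g n  ≈⟨ +-congʳ (zeroˡ _) ⟩
    0# + f 1 * g n              ≈⟨ +-identityˡ _ ⟩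
    f 1 * g n                   ∎

  z-⊛ : ∀ g n → (z ⊛ g) (suc n) ≈ g n
  z-⊛ g n = trans (⊛-linearˡ z g refl (λ _ → refl) n) (*-identityˡ _)

  ⊖z-⊛ : ∀ g n → (⊖ z ⊛ g) (suc n) ≈ - g n
  ⊖z-⊛ g n = trans (⊛-linearˡ (⊖ z) g -0≈0 (λ _ → -0≈0) n)
    (solve 1 (λ x → (:- :1) :* x := :- x) refl (g n))
    where
    -0≈0 : - 0# ≈ 0#
    -0≈0 = solve 0 (:- :0 := :0) refl

  module Quadratic (f : Series) {a₀ a₁ a₂ : Carrier}
                   (f₀≈ : f 0 ≈ a₀) (f₁≈ : f 1 ≈ a₁)
                   (f₂≈ : f 2 ≈ a₂) (f≈0 : ∀ k → f (suc (suc (suc k))) ≈ 0#) where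

    ⊛₀ : ∀ g → (f ⊛ g) 0 ≈ a₀ * g 0
    ⊛₀ g = trans (+-identityʳ _) (*-congʳ f₀≈)

    ⊛₁ : ∀ g → (f ⊛ g) 1 ≈ a₀ * g 1 + a₁ * g 0
    ⊛₁ g = +-cong (*-congʳ f₀≈) (trans (+-identityʳ _) (*-congʳ f₁≈))

    ⊛₂₊ : ∀ g n → (f ⊛ g) (suc (suc n)) ≈
                  a₀ * g (suc (suc n)) + (a₁ * g (suc n) + a₂ * g n)
    ⊛₂₊ g n = +-cong (*-congʳ f₀≈) (+-cong (*-congʳ f₁≈)
      (trans (⊛-constantˡ (f ∘ suc ∘ suc) g f≈0 n) (*-congʳ f₂≈)))

  -- The inverse of `- 1 + v z + e z^2`: since the constant term is -1, comparing coefficients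
  -- determines each value from the two before it.
  reciprocal : Carrier → Carrier → Series
  reciprocal v e 0             = - 1#
  reciprocal v e 1             = - v
  reciprocal v e (suc (suc n)) = v * reciprocal v e (suc n) + e * reciprocal v e n

  module _ (v d e : Carrier) where

    -- The form is that of the fraction in the theorem. Expanded, the numerator is `- v z - d v z^2`
    -- and the denominator `- 1 + v z + e z^2`.
    numerator denominator : Series
    numerator   = ⊖ z ⊛ (const 1# ⊕ const d ⊛ z) ⊛ const v
    denominator = z ⊛ const v ⊖ const 1# ⊕ const e ⊛ (z ⊛ z)

    denominator-coeff : ∀ n → denominator n ≈ z n * v - const 1# n + e * (z ⊛ z) n
    denominator-coeff n = +-cong (+-congʳ (⊛-const z v n)) (const-⊛ e (z ⊛ z) n)

    denominator₀ : denominator 0 ≈ - 1#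
    denominator₀ = trans (denominator-coeff 0)
      (solve 2 (λ v e → :0 :* v :- :1 :+ e :* (:0 :* :0 :+ :0) := :- :1) refl v e)

    denominator₁ : denominator 1 ≈ v
    denominator₁ = trans (denominator-coeff 1) (trans (+-congˡ (*-congˡ (z-⊛ z 0)))
      (solve 2 (λ v e → :1 :* v :- :0 :+ e :* :0 := v) refl v e))

    denominator₂ : denominator 2 ≈ e
    denominator₂ = trans (denominator-coeff 2) (trans (+-congˡ (*-congˡ (z-⊛ z 1)))
      (solve 2 (λ v e → :0 :* v :- :0 :+ e :* :1 := e) refl v e))

    denominator₃ : ∀ k → denominator (suc (suc (suc k))) ≈ 0#
    denominator₃ k = trans (denominator-coeff (suc (suc (suc k))))
      (trans (+-congˡ (*-congˡ (z-⊛ z (suc (suc k)))))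
        (solve 2 (λ v e → :0 :* v :- :0 :+ e :* :0 := :0) refl v e))

    module Denominator =
      Quadratic denominator denominator₀ denominator₁ denominator₂ denominator₃

    denominator-inverse : denominator ⊛ reciprocal v e ≋ const 1#
    denominator-inverse zero = trans
      (Denominator.⊛₀ (reciprocal v e))
      (solve 0 ((:- :1) :* (:- :1) := :1) refl)
    denominator-inverse (suc zero) = trans
      (Denominator.⊛₁ (reciprocal v e))
      (solve 1 (λ v → (:- :1) :* (:- v) :+ v :* (:- :1) := :0) refl v)
    denominator-inverse (suc (suc n)) = trans
      (Denominator.⊛₂₊ (reciprocal v e) n)
      (solve 4 (λ v e x y → (:- :1) :* (v :* y :+ e :* x) :+ (v :* y :+ e :* x) := :0)
        refl v e (reciprocal v e n) (reciprocal v e (suc n)))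

    numerator-coeff : ∀ n → numerator (suc n) ≈ - (const 1# n + d * z n) * v
    numerator-coeff n = trans (⊛-const (⊖ z ⊛ (const 1# ⊕ const d ⊛ z)) v (suc n))
      (*-congʳ (trans (⊖z-⊛ (const 1# ⊕ const d ⊛ z) n) (-‿cong (+-congˡ (const-⊛ d z n)))))

    numerator₀ : numerator 0 ≈ 0#
    numerator₀ = trans (⊛-const (⊖ z ⊛ (const 1# ⊕ const d ⊛ z)) v 0)
      (trans (*-congʳ (+-identityʳ _))
        (solve 2 (λ v x → (:- :0) :* x :* v := :0) refl v ((const 1# ⊕ const d ⊛ z) 0)))

    numerator₁ : numerator 1 ≈ - v
    numerator₁ = trans (numerator-coeff 0)
      (solve 2 (λ v d → (:- (:1 :+ d :* :0)) :* v := :- v) refl v d)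

    numerator₂ : numerator 2 ≈ - (d * v)
    numerator₂ = trans (numerator-coeff 1)
      (solve 2 (λ v d → (:- (:0 :+ d :* :1)) :* v := :- (d :* v)) refl v d)

    numerator₃ : ∀ k → numerator (suc (suc (suc k))) ≈ 0#
    numerator₃ k = trans (numerator-coeff (suc (suc k)))
      (solve 2 (λ v d → (:- (:0 :+ d :* :0)) :* v := :0) refl v d)

    module Numerator =
      Quadratic numerator numerator₀ numerator₁ numerator₂ numerator₃

    -- From degree 2 on, a coefficient of `numerator ⊛ h` is a fixed combination of two consecutive
    -- values of `h`. The product thus inherits the recurrence of `h`, which is that of `s`, and
    -- agreement in low degrees propagates.
    quotient : (s : Series) → s 0 ≈ 0# → s 1 ≈ v → s 2 ≈ v * v + d * v →
               (∀ n → s (suc (suc (suc n))) ≈ v * s (suc (suc n)) + e * s (suc n)) →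
               s ≋ numerator ⊘ denominator
    quotient s s₀ s₁ s₂ recurrence = h , denominator-inverse , s≋
      where
      h : Series
      h = reciprocal v e

      coeff : ∀ n → (numerator ⊛ h) (suc (suc n)) ≈ - v * h (suc n) + - (d * v) * h n
      coeff n = trans (Numerator.⊛₂₊ h n) (trans (+-congʳ (zeroˡ _)) (+-identityˡ _))

      s≋ : s ≋ numerator ⊛ h
      s≋ zero = trans s₀ (sym (trans (Numerator.⊛₀ h) (zeroˡ _)))
      s≋ (suc zero) = trans s₁ (sym (trans (Numerator.⊛₁ h)
        (solve 1 (λ v → :0 :* (:- v) :+ (:- v) :* (:- :1) := v) refl v)))
      s≋ (suc (suc zero)) = trans s₂ (sym (trans (coeff 0)
        (solve 2 (λ v d → (:- v) :* (:- v) :+ (:- (d :* v)) :* (:- :1)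
                          := v :* v :+ d :* v) refl v d)))
      -- The recurrence reaches back to degree 1 here, where `coeff` does not apply yet.
      s≋ (suc (suc (suc zero))) = begin
        s 3                             ≈⟨ recurrence 0 ⟩
        v * s 2 + e * s 1               ≈⟨ +-cong (*-congˡ s₂) (*-congˡ s₁) ⟩
        v * (v * v + d * v) + e * v     ≈⟨ solve 3 (λ v d e →
            v :* (v :* v :+ d :* v) :+ e :* v
            := (:- v) :* (v :* (:- v) :+ e :* (:- :1)) :+ (:- (d :* v)) :* (:- v))
            refl v d e ⟩
        - v * h 2 + - (d * v) * h 1     ≈⟨ coeff 1 ⟨
        (numerator ⊛ h) 3               ∎
      s≋ (suc (suc (suc (suc n)))) = begin
        s (suc (suc (suc (suc n))))
          ≈⟨ recurrence (suc n) ⟩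
        v * s (suc (suc (suc n))) + e * s (suc (suc n))
          ≈⟨ +-cong (*-congˡ (trans (s≋ (suc (suc (suc n)))) (coeff (suc n))))
                    (*-congˡ (trans (s≋ (suc (suc n))) (coeff n))) ⟩
        v * (- v * h₂ + - (d * v) * h₁) + e * (- v * h₁ + - (d * v) * h₀)
          ≈⟨ solve 5 (λ v d e x y → let y′ = v :* y :+ e :* x in
               v :* ((:- v) :* y′ :+ (:- (d :* v)) :* y) :+
               e :* ((:- v) :* y :+ (:- (d :* v)) :* x)
               := (:- v) :* (v :* y′ :+ e :* y) :+ (:- (d :* v)) :* y′) refl v d e h₀ h₁ ⟩
        - v * h (suc (suc (suc n))) + - (d * v) * h₂
          ≈⟨ coeff (suc (suc n)) ⟨
        (numerator ⊛ h) (suc (suc (suc (suc n)))) ∎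
        where
        h₀ h₁ h₂ : Carrier
        h₀ = h n
        h₁ = h (suc n)
        h₂ = h (suc (suc n))

-- Expectations

module ShelfProperties {c ℓ₁ ℓ₂ ℓ₃} (K : OrderedField c ℓ₁ ℓ₂ ℓ₃)
                       (p : OrderedField.Carrier K) where
  open OrderedField K using (commutativeRing)
  open CommutativeRing commutativeRing
  open Shelf K p
  open IntegerCoefficients commutativeRing
  open SeriesProperties commutativeRing
  open ≈-Reasoning setoid

  total : (Vec Side m → Carrier) → List (Vec Side m) → Carrier
  total Y = foldr _+_ 0# ∘ map (λ ω → prob ω * Y ω)

  total-++ : ∀ (Y : Vec Side m → Carrier) ωs ωs′ →
             total Y (ωs ++ ωs′) ≈ total Y ωs + total Y ωs′
  total-++ Y []       ωs′ = sym (+-identityˡ _)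
  total-++ Y (ω ∷ ωs) ωs′ = trans (+-congˡ (total-++ Y ωs ωs′)) (sym (+-assoc _ _ _))

  total-∷ : ∀ s (Y : Vec Side (suc m) → Carrier) ωs →
            total Y (map (s ∷_) ωs) ≈ weight s * total (Y ∘ (s ∷_)) ωs
  total-∷ s Y []       = sym (zeroʳ _)
  total-∷ s Y (ω ∷ ωs) = trans
    (+-cong (*-assoc _ _ _) (total-∷ s Y ωs)) (sym (distribˡ _ _ _))

  -- The expectation computed by conditioning on the first placement, which allows induction on the
  -- number of placements.
  𝔼ʳ : ∀ m → (Vec Side m → Carrier) → Carrier
  𝔼ʳ zero    Y = Y []
  𝔼ʳ (suc m) Y = p * 𝔼ʳ m (Y ∘ (top ∷_)) + (1# - p) * 𝔼ʳ m (Y ∘ (bottom ∷_))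

  𝔼≈𝔼ʳ : ∀ m (Y : Vec Side m → Carrier) → 𝔼 Y ≈ 𝔼ʳ m Y
  𝔼≈𝔼ʳ zero    Y = trans (+-identityʳ _) (*-identityˡ _)
  𝔼≈𝔼ʳ (suc m) Y = begin
    𝔼 Y
      ≈⟨ total-++ Y (map (top ∷_) (outcomes m)) (map (bottom ∷_) (outcomes m)) ⟩
    total Y (map (top ∷_) (outcomes m)) + total Y (map (bottom ∷_) (outcomes m))
      ≈⟨ +-cong (total-∷ top Y (outcomes m)) (total-∷ bottom Y (outcomes m)) ⟩
    p * 𝔼 (Y ∘ (top ∷_)) + (1# - p) * 𝔼 (Y ∘ (bottom ∷_))
      ≈⟨ +-cong (*-congˡ (𝔼≈𝔼ʳ m (Y ∘ (top ∷_)))) (*-congˡ (𝔼≈𝔼ʳ m (Y ∘ (bottom ∷_)))) ⟩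
    𝔼ʳ (suc m) Y ∎

  𝔼ʳ-cong : ∀ m {Y Z : Vec Side m → Carrier} → (∀ ω → Y ω ≈ Z ω) → 𝔼ʳ m Y ≈ 𝔼ʳ m Z
  𝔼ʳ-cong zero    Y≈Z = Y≈Z []
  𝔼ʳ-cong (suc m) Y≈Z = +-cong (*-congˡ (𝔼ʳ-cong m (Y≈Z ∘ (top ∷_))))
                               (*-congˡ (𝔼ʳ-cong m (Y≈Z ∘ (bottom ∷_))))

  𝔼ʳ-const : ∀ m a → 𝔼ʳ m (λ _ → a) ≈ a
  𝔼ʳ-const zero    a = refl
  𝔼ʳ-const (suc m) a = trans (+-cong (*-congˡ (𝔼ʳ-const m a)) (*-congˡ (𝔼ʳ-const m a)))
    (solve 2 (λ p a → p :* a :+ (:1 :- p) :* a := a) refl p a)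

  𝔼ʳ-+ : ∀ m (Y Z : Vec Side m → Carrier) → 𝔼ʳ m (λ ω → Y ω + Z ω) ≈ 𝔼ʳ m Y + 𝔼ʳ m Z
  𝔼ʳ-+ zero    Y Z = refl
  𝔼ʳ-+ (suc m) Y Z = trans
    (+-cong (*-congˡ (𝔼ʳ-+ m (Y ∘ (top ∷_)) (Z ∘ (top ∷_))))
            (*-congˡ (𝔼ʳ-+ m (Y ∘ (bottom ∷_)) (Z ∘ (bottom ∷_)))))
    (solve 5 (λ p y z y′ z′ → p :* (y :+ z) :+ (:1 :- p) :* (y′ :+ z′)
                := p :* y :+ (:1 :- p) :* y′ :+ (p :* z :+ (:1 :- p) :* z′))
      refl p _ _ _ _)

  𝔼ʳ-scale : ∀ m a (Y : Vec Side m → Carrier) → 𝔼ʳ m (λ ω → a * Y ω) ≈ a * 𝔼ʳ m Y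
  𝔼ʳ-scale zero    a Y = refl
  𝔼ʳ-scale (suc m) a Y = trans
    (+-cong (*-congˡ (𝔼ʳ-scale m a (Y ∘ (top ∷_))))
            (*-congˡ (𝔼ʳ-scale m a (Y ∘ (bottom ∷_)))))
    (solve 4 (λ p a y y′ → p :* (a :* y) :+ (:1 :- p) :* (a :* y′)
                := a :* (p :* y :+ (:1 :- p) :* y′))
      refl p a _ _)

  -- The squared deviation from the mean and the shifts of `k` and `k^2` in the moment recurrences
  -- are all quadratic, so this one form of linearity serves for both moments.
  𝔼ʳ-quadratic : ∀ m a b d (Y : Vec Side m → Carrier) →
    𝔼ʳ m (λ ω → a + b * Y ω + d * Y ω ^ 2) ≈ a + b * 𝔼ʳ m Y + d * 𝔼ʳ m (λ ω → Y ω ^ 2)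
  𝔼ʳ-quadratic m a b d Y = begin
    𝔼ʳ m (λ ω → a + b * Y ω + d * Y ω ^ 2)
      ≈⟨ 𝔼ʳ-+ m (λ ω → a + b * Y ω) (λ ω → d * Y ω ^ 2) ⟩
    𝔼ʳ m (λ ω → a + b * Y ω) + 𝔼ʳ m (λ ω → d * Y ω ^ 2)
      ≈⟨ +-cong (𝔼ʳ-+ m (λ _ → a) (λ ω → b * Y ω)) (𝔼ʳ-scale m d (λ ω → Y ω ^ 2)) ⟩
    𝔼ʳ m (λ _ → a) + 𝔼ʳ m (λ ω → b * Y ω) + d * 𝔼ʳ m (λ ω → Y ω ^ 2)
      ≈⟨ +-congʳ (+-cong (𝔼ʳ-const m a) (𝔼ʳ-scale m b Y)) ⟩
    a + b * 𝔼ʳ m Y + d * 𝔼ʳ m (λ ω → Y ω ^ 2) ∎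

  𝕍-moments : ∀ m (Y : Vec Side m → Carrier) → 𝕍 Y ≈ 𝔼ʳ m (λ ω → Y ω ^ 2) - 𝔼ʳ m Y ^ 2
  𝕍-moments m Y = begin
    𝔼 (λ ω → (Y ω - 𝔼 Y) ^ 2)
      ≈⟨ 𝔼≈𝔼ʳ m (λ ω → (Y ω - 𝔼 Y) ^ 2) ⟩
    𝔼ʳ m (λ ω → (Y ω - 𝔼 Y) ^ 2)
      ≈⟨ 𝔼ʳ-cong m (λ ω → ^-cong (+-congˡ {Y ω} (-‿cong (𝔼≈𝔼ʳ m Y)))) ⟩
    𝔼ʳ m (λ ω → (Y ω - μ) ^ 2)
      ≈⟨ 𝔼ʳ-cong m (λ ω → solve 2 (λ y μ → (y :- μ) :^ 2 :=
           μ :^ 2 :+ (:- ((:1 :+ :1) :* μ)) :* y :+ :1 :* y :^ 2) refl (Y ω) μ) ⟩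
    𝔼ʳ m (λ ω → μ ^ 2 + - ((1# + 1#) * μ) * Y ω + 1# * Y ω ^ 2)
      ≈⟨ 𝔼ʳ-quadratic m (μ ^ 2) (- ((1# + 1#) * μ)) 1# Y ⟩
    μ ^ 2 + - ((1# + 1#) * μ) * μ + 1# * 𝔼ʳ m (λ ω → Y ω ^ 2)
      ≈⟨ solve 2 (λ s μ → μ :^ 2 :+ (:- ((:1 :+ :1) :* μ)) :* μ :+ :1 :* s
                          := s :- μ :^ 2) refl (𝔼ʳ m (λ ω → Y ω ^ 2)) μ ⟩
    𝔼ʳ m (λ ω → Y ω ^ 2) - μ ^ 2 ∎
    where
    μ = 𝔼ʳ m Y
    ^-cong : ∀ {x y} → x ≈ y → x ^ 2 ≈ y ^ 2
    ^-cong x≈y = *-cong x≈y (*-congʳ x≈y)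

  -- The side is the state of a two-state chain, namely the preceding placement; the game itself
  -- starts in state `top`.
  𝔼ₛ : Side → ℕ → (ℕ → Carrier) → Carrier
  𝔼ₛ s m f = 𝔼ʳ m (f ∘ score s)

  𝔼ʳX≈𝔼ₛ : ∀ m (f : ℕ → Carrier) → 𝔼ʳ (suc m) (f ∘ X) ≈ 𝔼ₛ top m f
  𝔼ʳX≈𝔼ₛ m f = trans
    (+-cong (*-congˡ (𝔼ʳ-cong m (λ ω → reflexive (≡.cong f (X≡score top ω)))))
            (*-congˡ (𝔼ʳ-cong m (λ ω → reflexive (≡.cong f (X≡score bottom ω))))))
    (solve 2 (λ p x → p :* x :+ (:1 :- p) :* x := x) refl p (𝔼ₛ top m f))

  𝔼X≈𝔼ₛ : ∀ m (f : ℕ → Carrier) → 𝔼 {suc m} (f ∘ X) ≈ 𝔼ₛ top m f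
  𝔼X≈𝔼ₛ m f = trans (𝔼≈𝔼ʳ (suc m) (f ∘ X)) (𝔼ʳX≈𝔼ₛ m f)

  -- If `ss` begins with `bottom`, then `score bottom ss` equals `suc (score top ss)`. So after a
  -- first `bottom`, passing to state `top` and `f ∘ suc` changes the value only if `top` follows.
  -- This has probability `p * (1# - p)` and gives the correction term; the expectation in state
  -- `bottom` cancels.
  𝔼ₛ-recurrence : ∀ m (f : ℕ → Carrier) → 𝔼ₛ top (suc (suc m)) f ≈
    𝔼ₛ top (suc m) (f ∘ suc) +
    p * (1# - p) * (𝔼ₛ top m (f ∘ suc) - 𝔼ₛ top m (f ∘ suc ∘ suc))
  𝔼ₛ-recurrence m f = solve 4 (λ p t₁ t₂ b₁ →
    p :* (p :* t₂ :+ (:1 :- p) :* b₁) :+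
    (:1 :- p) :* (p :* t₁ :+ (:1 :- p) :* b₁)
    := p :* t₂ :+ (:1 :- p) :* b₁ :+
       p :* (:1 :- p) :* (t₁ :- t₂)) refl
    p (𝔼ₛ top m (f ∘ suc)) (𝔼ₛ top m (f ∘ suc ∘ suc)) (𝔼ₛ bottom m (f ∘ suc))

  -- The generating function

  module _ (v : Carrier) where
    d e : Carrier
    d = (v - 1#) * (p - 1#)
    e = p * v * (v - 1#) * (p - 1#)

    S-1 : S v 1 ≈ v
    S-1 = trans (𝔼X≈𝔼ₛ 0 (v ^_)) (*-identityʳ v)

    S-2 : S v 2 ≈ v * v + d * v
    S-2 = begin
      S v 2
        ≈⟨ 𝔼X≈𝔼ₛ 1 (v ^_) ⟩
      p * v ^ 2 + (1# - p) * v ^ 1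
        ≈⟨ solve 2 (λ p v →
             p :* v :^ 2 :+ (:1 :- p) :* v :^ 1
             := v :* v :+ (v :- :1) :* (p :- :1) :* v) refl p v ⟩
      v * v + d * v ∎

    S-recurrence : ∀ n → S v (suc (suc (suc n))) ≈ v * S v (suc (suc n)) + e * S v (suc n)
    S-recurrence n = begin
      S v (suc (suc (suc n)))
        ≈⟨ trans (𝔼X≈𝔼ₛ (suc (suc n)) (v ^_)) (𝔼ₛ-recurrence n (v ^_)) ⟩
      𝔼ₛ top (suc n) (λ k → v * v ^ k) +
      p * (1# - p) * (𝔼ₛ top n (λ k → v * v ^ k) - 𝔼ₛ top n (λ k → v * (v * v ^ k)))
        -- For powers of `v`, each shift of the argument comes out as a factor `v`.
        ≈⟨ +-cong (scale (suc n)) (*-congˡ (+-cong (scale n)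
             (-‿cong (trans (𝔼ʳ-scale n v (λ ω → v * v ^ score top ω))
                     (*-congˡ (scale n)))))) ⟩
      v * 𝔼ₛ top (suc n) (v ^_) +
      p * (1# - p) * (v * 𝔼ₛ top n (v ^_) - v * (v * 𝔼ₛ top n (v ^_)))
        ≈⟨ solve 4 (λ p v x y →
             v :* y :+ p :* (:1 :- p) :* (v :* x :- v :* (v :* x))
             := v :* y :+ p :* v :* (v :- :1) :* (p :- :1) :* x)
             refl p v (𝔼ₛ top n (v ^_)) (𝔼ₛ top (suc n) (v ^_)) ⟩
      v * 𝔼ₛ top (suc n) (v ^_) + e * 𝔼ₛ top n (v ^_)
        ≈⟨ +-cong (*-congˡ (𝔼X≈𝔼ₛ (suc n) (v ^_))) (*-congˡ (𝔼X≈𝔼ₛ n (v ^_))) ⟨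
      v * S v (suc (suc n)) + e * S v (suc n) ∎
      where
      scale : ∀ m → 𝔼ₛ top m (λ k → v * v ^ k) ≈ v * 𝔼ₛ top m (v ^_)
      scale m = 𝔼ʳ-scale m v (λ ω → v ^ score top ω)

    S-quotient : S v ≋ numerator v d e ⊘ denominator v d e
    S-quotient = quotient v d e (S v) refl S-1 S-2 S-recurrence

  -- Mean and variance

  -- The moments of the game with m + 1 cards.
  M₁ M₂ : ℕ → Carrier
  M₁ m = 𝔼ₛ top m ι
  M₂ m = 𝔼ₛ top m (λ k → ι k ^ 2)

  𝔼ₛ-quadratic : ∀ m a b d {f : ℕ → Carrier} → (∀ k → f k ≈ a + b * ι k + d * ι k ^ 2) →
                 𝔼ₛ top m f ≈ a + b * M₁ m + d * M₂ m
  𝔼ₛ-quadratic m a b d f≈ =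
    trans (𝔼ʳ-cong m (f≈ ∘ score top)) (𝔼ʳ-quadratic m a b d (ι ∘ score top))

  mean : Carrier → Carrier
  mean N = (1# - p + p ^ 2) * N + ι 3 * p - 1# - ι 2 * p ^ 2

  variance : Carrier → Carrier
  variance N = (1# - p) * p * (ι 3 * p ^ 2 - ι 3 * p + 1#) * N
                + p * (1# - p) * (ι 10 * p - ι 8 * p ^ 2 - ι 3)

  private
    -- Written with `:×` rather than as a coefficient, a numeral evaluates to the same sum of ones
    -- as `ι n`.
    :ι : ∀ {k} → ℕ → Polynomial k
    :ι n = n :× :1
    :mean :variance : ∀ {k} → Polynomial k → Polynomial k → Polynomial k
    :mean P N = (:1 :- P :+ P :^ 2) :* N :+ :ι 3 :* P :- :1 :- :ι 2 :* P :^ 2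
    :variance P N = (:1 :- P) :* P :* (:ι 3 :* P :^ 2 :- :ι 3 :* P :+ :1) :* N
      :+ P :* (:1 :- P) :* (:ι 10 :* P :- :ι 8 :* P :^ 2 :- :ι 3)

  -- For `f = ι` the two expectations in the correction term differ by exactly 1. So `M₁ m` drops
  -- out, and the mean grows by the constant `1 - p + p^2`.
  M₁-recurrence : ∀ m → M₁ (suc (suc m)) ≈ 1# + M₁ (suc m) - p * (1# - p)
  M₁-recurrence m = begin
    M₁ (suc (suc m))
      ≈⟨ 𝔼ₛ-recurrence m ι ⟩
    𝔼ₛ top (suc m) (ι ∘ suc) + p * (1# - p) * (𝔼ₛ top m (ι ∘ suc) - 𝔼ₛ top m (ι ∘ suc ∘ suc))
      ≈⟨ +-cong (𝔼ₛ-quadratic (suc m) 1# 1# 0# ι-suc)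
           (*-congˡ (+-cong (𝔼ₛ-quadratic m 1# 1# 0# ι-suc)
             (-‿cong (𝔼ₛ-quadratic m (1# + 1#) 1# 0# ι-suc-suc)))) ⟩
    1# + 1# * M₁ (suc m) + 0# * M₂ (suc m) + p * (1# - p) *
      (1# + 1# * M₁ m + 0# * M₂ m - (1# + 1# + 1# * M₁ m + 0# * M₂ m))
      ≈⟨ solve 5 (λ p x y x′ y′ →
           :1 :+ :1 :* x′ :+ :0 :* y′ :+ p :* (:1 :- p) :*
             (:1 :+ :1 :* x :+ :0 :* y :- ((:1 :+ :1) :+ :1 :* x :+ :0 :* y))
           := :1 :+ x′ :- p :* (:1 :- p))
           refl p (M₁ m) (M₂ m) (M₁ (suc m)) (M₂ (suc m)) ⟩
    1# + M₁ (suc m) - p * (1# - p) ∎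
    where
    ι-suc : ∀ k → ι (suc k) ≈ 1# + 1# * ι k + 0# * ι k ^ 2
    ι-suc k = solve 1 (λ x → :1 :+ x := :1 :+ :1 :* x :+ :0 :* x :^ 2) refl (ι k)
    ι-suc-suc : ∀ k → ι (suc (suc k)) ≈ 1# + 1# + 1# * ι k + 0# * ι k ^ 2
    ι-suc-suc k = solve 1 (λ x → :1 :+ (:1 :+ x)
      := (:1 :+ :1) :+ :1 :* x :+ :0 :* x :^ 2) refl (ι k)

  -- Since `(k+1)^2 - (k+2)^2 = - (3 + 2k)`, the correction term involves only the mean of the game
  -- with two cards fewer.
  M₂-recurrence : ∀ m → M₂ (suc (suc m)) ≈
    1# + ι 2 * M₁ (suc m) + M₂ (suc m) - p * (1# - p) * (ι 3 + ι 2 * M₁ m)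
  M₂-recurrence m = begin
    M₂ (suc (suc m))
      ≈⟨ 𝔼ₛ-recurrence m (λ k → ι k ^ 2) ⟩
    𝔼ₛ top (suc m) (λ k → ι (suc k) ^ 2) + p * (1# - p) *
      (𝔼ₛ top m (λ k → ι (suc k) ^ 2) - 𝔼ₛ top m (λ k → ι (suc (suc k)) ^ 2))
      ≈⟨ +-cong (𝔼ₛ-quadratic (suc m) 1# (ι 2) 1# ι-suc)
           (*-congˡ (+-cong (𝔼ₛ-quadratic m 1# (ι 2) 1# ι-suc)
             (-‿cong (𝔼ₛ-quadratic m (ι 4) (ι 4) 1# ι-suc-suc)))) ⟩
    1# + ι 2 * M₁ (suc m) + 1# * M₂ (suc m) + p * (1# - p) *
      (1# + ι 2 * M₁ m + 1# * M₂ m - (ι 4 + ι 4 * M₁ m + 1# * M₂ m))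
      ≈⟨ solve 5 (λ p x y x′ y′ →
           :1 :+ :ι 2 :* x′ :+ :1 :* y′ :+ p :* (:1 :- p) :*
             (:1 :+ :ι 2 :* x :+ :1 :* y :- (:ι 4 :+ :ι 4 :* x :+ :1 :* y))
           := :1 :+ :ι 2 :* x′ :+ y′ :- p :* (:1 :- p) :* (:ι 3 :+ :ι 2 :* x))
           refl p (M₁ m) (M₂ m) (M₁ (suc m)) (M₂ (suc m)) ⟩
    1# + ι 2 * M₁ (suc m) + M₂ (suc m) - p * (1# - p) * (ι 3 + ι 2 * M₁ m) ∎
    where
    ι-suc : ∀ k → ι (suc k) ^ 2 ≈ 1# + ι 2 * ι k + 1# * ι k ^ 2
    ι-suc k = solve 1 (λ x → (:1 :+ x) :^ 2
      := :1 :+ :ι 2 :* x :+ :1 :* x :^ 2) refl (ι k)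
    ι-suc-suc : ∀ k → ι (suc (suc k)) ^ 2 ≈ ι 4 + ι 4 * ι k + 1# * ι k ^ 2
    ι-suc-suc k = solve 1 (λ x → (:1 :+ (:1 :+ x)) :^ 2
      := :ι 4 :+ :ι 4 :* x :+ :1 :* x :^ 2) refl (ι k)

  -- The induction starts at two cards; for one card the closed form would give `2p - p^2` instead
  -- of 1.
  M₁-closed : ∀ m → M₁ (suc m) ≈ mean (ι (suc (suc m)))
  M₁-closed zero    = solve 1 (λ p → p :* :ι 2 :+ (:1 :- p) :* :ι 1 := :mean p (:ι 2)) refl p
  M₁-closed (suc m) = begin
    M₁ (suc (suc m))
      ≈⟨ M₁-recurrence m ⟩
    1# + M₁ (suc m) - p * (1# - p)
      ≈⟨ +-congʳ (+-congˡ (M₁-closed m)) ⟩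
    1# + mean (ι (suc (suc m))) - p * (1# - p)
      ≈⟨ solve 2 (λ p N → :1 :+ :mean p N :- p :* (:1 :- p)
                          := :mean p (:1 :+ N)) refl p (ι (suc (suc m))) ⟩
    mean (ι (suc (suc (suc m)))) ∎

  -- Two cards are too few: for n = 2 the closed form of the variance fails.
  M₂-closed : ∀ m → M₂ (suc (suc m)) ≈
              variance (ι (suc (suc (suc m)))) + mean (ι (suc (suc (suc m)))) ^ 2
  M₂-closed zero = begin
    M₂ 2
      ≈⟨ M₂-recurrence 0 ⟩
    1# + ι 2 * M₁ 1 + M₂ 1 - p * (1# - p) * (ι 3 + ι 2 * M₁ 0)
      -- The closed form of the mean does not cover `M₁ 0`, so the games with one and two cards are
      -- evaluated directly: the score is 1 for one card, and for two cards it is 2 with probability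
      -- `p` and 1 otherwise.
      ≈⟨ solve 1 (λ p →
           :1 :+ :ι 2 :* (p :* :ι 2 :+ (:1 :- p) :* :ι 1)
             :+ (p :* :ι 2 :^ 2 :+ (:1 :- p) :* :ι 1 :^ 2)
             :- p :* (:1 :- p) :* (:ι 3 :+ :ι 2 :* :ι 1)
           := :variance p (:ι 3) :+ :mean p (:ι 3) :^ 2) refl p ⟩
    variance (ι 3) + mean (ι 3) ^ 2 ∎
  M₂-closed (suc m) = begin
    M₂ (suc (suc (suc m)))
      ≈⟨ M₂-recurrence (suc m) ⟩
    1# + ι 2 * M₁ (suc (suc m)) + M₂ (suc (suc m)) - p * (1# - p) * (ι 3 + ι 2 * M₁ (suc m))
      ≈⟨ +-cong (+-cong (+-congˡ (*-congˡ (M₁-closed (suc m)))) (M₂-closed m))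
                (-‿cong (*-congˡ (+-congˡ (*-congˡ (M₁-closed m))))) ⟩
    1# + ι 2 * mean N₃ + (variance N₃ + mean N₃ ^ 2) - p * (1# - p) * (ι 3 + ι 2 * mean N₂)
      ≈⟨ solve 2 (λ p N → let N₁ = :1 :+ N in
           :1 :+ :ι 2 :* :mean p N₁ :+ (:variance p N₁ :+ :mean p N₁ :^ 2)
             :- p :* (:1 :- p) :* (:ι 3 :+ :ι 2 :* :mean p N)
           := :variance p (:1 :+ N₁) :+ :mean p (:1 :+ N₁) :^ 2) refl p N₂ ⟩
    variance (ι (suc (suc (suc (suc m))))) + mean (ι (suc (suc (suc (suc m))))) ^ 2 ∎
    where
    N₂ = ι (suc (suc m))
    N₃ = ι (suc (suc (suc m)))

  𝔼X : ∀ n → 3 ≤ℕ n → 𝔼 {n} (λ ω → ι (X ω)) ≈ mean (ι n)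
  𝔼X _ (s≤s (s≤s (s≤s {n = m} _))) = trans (𝔼X≈𝔼ₛ (suc (suc m)) ι) (M₁-closed (suc m))

  𝕍X : ∀ n → 3 ≤ℕ n → 𝕍 {n} (λ ω → ι (X ω)) ≈ variance (ι n)
  𝕍X n (s≤s (s≤s (s≤s {n = m} _))) = begin
    𝕍 {n} (λ ω → ι (X ω))
      ≈⟨ 𝕍-moments n (λ ω → ι (X ω)) ⟩
    𝔼ʳ n (λ ω → ι (X ω) ^ 2) - μ ^ 2
      ≈⟨ +-cong (trans (𝔼ʳX≈𝔼ₛ (suc (suc m)) (λ k → ι k ^ 2)) (M₂-closed m))
                (-‿cong (*-cong μ≈ (*-congʳ μ≈))) ⟩
    variance (ι n) + mean (ι n) ^ 2 - mean (ι n) ^ 2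
      ≈⟨ solve 2 (λ x y → x :+ y :- y := x) refl (variance (ι n)) (mean (ι n) ^ 2) ⟩
    variance (ι n) ∎
    where
    μ = 𝔼ʳ n (λ ω → ι (X ω))
    μ≈ : μ ≈ mean (ι n)
    μ≈ = trans (𝔼ʳX≈𝔼ₛ (suc (suc m)) ι) (M₁-closed (suc m))

mainTheorem9 :
  ∀ {c ℓ₁ ℓ₂ ℓ₃} (K : OrderedField c ℓ₁ ℓ₂ ℓ₃) → let open OrderedField K in
  (p : Carrier) → ½ ≤ p → p < 1# → let open Shelf K p in
    (∀ (v : Carrier) →
      S v ≋ ⊖ z ⊛ (const 1# ⊕ const ((v - 1#) * (p - 1#)) ⊛ z) ⊛ const v
          ⊘ z ⊛ const v ⊖ const 1# ⊕ const (p * v * (v - 1#) * (p - 1#)) ⊛ (z ⊛ z))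
    × (∀ (n : ℕ) → 3 ≤ℕ n →
        (𝔼 {n} (λ ω → ι (X ω)) ≈ (1# - p + p ^ 2) * ι n + ι 3 * p - 1# - ι 2 * p ^ 2)
        × (𝕍 {n} (λ ω → ι (X ω))
            ≈ (1# - p) * p * (ι 3 * p ^ 2 - ι 3 * p + 1#) * ι n
              + p * (1# - p) * (ι 10 * p - ι 8 * p ^ 2 - ι 3)))
mainTheorem9 K p _ _ = S-quotient , λ n 3≤n → 𝔼X n 3≤n , 𝕍X n 3≤n
  where open ShelfProperties K p
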